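{- Over $\mathsf{RCA}_0$, $\mathsf{SEM}+\mathsf{SADS}$ implies $\mathsf{SRT}^2_2$.
   Context: All principles are statements of second order arithmetic; infinite structures have domain $\mathbb{N}$. An infinite tournament is an irreflexive binary relation $T$ on $\mathbb{N}$ such that for all $x\neq y$ exactly one of $T(x,y)$, $T(y,x)$ holds. It is stable if for all $x$ there is a $y$ such that either $T(x,z)$ holds for all $z>y$ or $T(z,x)$ holds for all $z>y$. $\mathsf{SEM}$: every infinite stable tournament contains an infinite transitive subtournament, i.e. an infinite set $S$ on which the relation $T$ is transitive. An infinite linear order $L=(\mathbb{N},<_L)$ is stable if it has order type $\omega+\omega^*$, which means: for every $x$ there is a $y$ such that either $x<_L z$ for all $z>y$ or $z<_L x$ for all $z>y$. $\mathsf{SADS}$: for every infinite stable linear order there is an $f:\mathbb{N}\to\mathbb{N}$ with either $f(n)<_L f(m)$ for all $n<m$, or $f(n)>_L f(m)$ for all $n<m$. A 2-coloring $c:[\mathbb{N}]^2\to\{0,1\}$ is stable if for every $n$ there is an $i\in\{0,1\}$ such that $c(n,y)=i$ for all but finitely many $y$. $\mathsf{SRT}^2_2$: every stable 2-coloring of $[\mathbb{N}]^2$ has an infinite homogeneous set, i.e. an infinite $H$ with $c$ constant on $[H]^2$. -}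

module Defs where

open import Data.Fin.Base using (Fin; zero; suc)
open import Data.Nat.Base using (ℕ; zero; suc)
open import Data.Product.Base using (_×_; Σ-syntax)
open import Data.Sum.Base using (_⊎_)
open import Data.Vec.Base using (Vec; []; _∷_; lookup)
open import Level using (Level) renaming (suc to lsuc)
open import Relation.Binary.PropositionalEquality.Core using (_≡_)
open import Relation.Nullary.Decidable.Core using (Dec)
open import Relation.Nullary.Negation.Core using (¬_)

private
  variable
    n n′ m m′ : ℕ

infixl 9 _·̇_
infixl 8 _+̇_
infix  7 _≐_ _<̇_ _∈̇_
infix  6 ¬̇_
infixr 5 _∧̇_
infixr 4 _∨̇_
infixr 3 _⇒_
infix  2 _⇔_
infix  2 ∀̇_ ∃̇_ ∀²_ ∃²_

data Term (n : ℕ) : Set where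
  var   : Fin n → Term n
  0̇ 1̇   : Term n
  _+̇_   : Term n → Term n → Term n
  _·̇_   : Term n → Term n → Term n

-- Formula n m: formulas with n free number variables and m free set
-- variables, both as de Bruijn indices. ∀̇ and ∃̇ bind a number variable,
-- ∀² and ∃² a set variable. Equality is primitive for numbers only.
data Formula (n m : ℕ) : Set where
  _≐_ _<̇_         : Term n → Term n → Formula n m
  _∈̇_             : Term n → Fin m → Formula n m
  ¬̇_              : Formula n m → Formula n m
  _∧̇_ _∨̇_ _⇒_     : Formula n m → Formula n m → Formula n m
  ∀̇_ ∃̇_           : Formula (suc n) m → Formula n m
  ∀²_ ∃²_         : Formula n (suc m) → Formula n m

Sentence : Set
Sentence = Formula 0 0

_⇔_ : Formula n m → Formula n m → Formula n m
φ ⇔ ψ = (φ ⇒ ψ) ∧̇ (ψ ⇒ φ)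

pattern x₀ = var zero
pattern x₁ = var (suc zero)
pattern x₂ = var (suc (suc zero))
pattern x₃ = var (suc (suc (suc zero)))

pattern X₀ = zero
pattern X₁ = suc zero

subTerm : (Fin n → Term n′) → Term n → Term n′
subTerm σ (var i) = σ i
subTerm σ 0̇       = 0̇
subTerm σ 1̇       = 1̇
subTerm σ (s +̇ t) = subTerm σ s +̇ subTerm σ t
subTerm σ (s ·̇ t) = subTerm σ s ·̇ subTerm σ t

wkTerm : Term n → Term (suc n)
wkTerm = subTerm (λ i → var (suc i))

liftSub : (Fin n → Term n′) → Fin (suc n) → Term (suc n′)
liftSub σ zero    = x₀
liftSub σ (suc i) = wkTerm (σ i)

liftRen : (Fin m → Fin m′) → Fin (suc m) → Fin (suc m′)
liftRen τ zero    = zero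
liftRen τ (suc i) = suc (τ i)

-- Substitutes terms for number variables and renames set variables.
sub : (Fin n → Term n′) → (Fin m → Fin m′) → Formula n m → Formula n′ m′
sub σ τ (s ≐ t)  = subTerm σ s ≐ subTerm σ t
sub σ τ (s <̇ t)  = subTerm σ s <̇ subTerm σ t
sub σ τ (t ∈̇ X)  = subTerm σ t ∈̇ τ X
sub σ τ (¬̇ φ)    = ¬̇ sub σ τ φ
sub σ τ (φ ∧̇ ψ)  = sub σ τ φ ∧̇ sub σ τ ψ
sub σ τ (φ ∨̇ ψ)  = sub σ τ φ ∨̇ sub σ τ ψ
sub σ τ (φ ⇒ ψ)  = sub σ τ φ ⇒ sub σ τ ψ
sub σ τ (∀̇ φ)    = ∀̇ sub (liftSub σ) τ φ
sub σ τ (∃̇ φ)    = ∃̇ sub (liftSub σ) τ φ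
sub σ τ (∀² φ)   = ∀² sub σ (liftRen τ) φ
sub σ τ (∃² φ)   = ∃² sub σ (liftRen τ) φ

atZero : Formula (suc n) m → Formula n m
atZero = sub (λ { zero → 0̇ ; (suc i) → var i }) (λ X → X)

-- φ(x + 1), where x = x₀ stays free
atSuc : Formula (suc n) m → Formula (suc n) m
atSuc = sub (λ { zero → x₀ +̇ 1̇ ; (suc i) → var (suc i) }) (λ X → X)

wkSet : Formula n m → Formula n (suc m)
wkSet = sub var suc

-- Set quantifiers range over the second sort 𝕊, not over all subsets of
-- 𝔻 (Henkin semantics).
record Structure (ℓ : Level) : Set (lsuc ℓ) where
  field
    𝔻 𝕊       : Set ℓ
    zeroᴹ oneᴹ : 𝔻
    _+ᴹ_ _·ᴹ_  : 𝔻 → 𝔻 → 𝔻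
    _<ᴹ_       : 𝔻 → 𝔻 → Set ℓ
    _∈ᴹ_       : 𝔻 → 𝕊 → Set ℓ

module _ {ℓ : Level} (M : Structure ℓ) where
  open Structure M

  ⟦_⟧ : Term n → Vec 𝔻 n → 𝔻
  ⟦ var i ⟧ ρ = lookup ρ i
  ⟦ 0̇ ⟧     ρ = zeroᴹ
  ⟦ 1̇ ⟧     ρ = oneᴹ
  ⟦ s +̇ t ⟧ ρ = ⟦ s ⟧ ρ +ᴹ ⟦ t ⟧ ρ
  ⟦ s ·̇ t ⟧ ρ = ⟦ s ⟧ ρ ·ᴹ ⟦ t ⟧ ρ

  Sat : Formula n m → Vec 𝔻 n → Vec 𝕊 m → Set ℓ
  Sat (s ≐ t)  ρ ξ = ⟦ s ⟧ ρ ≡ ⟦ t ⟧ ρ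
  Sat (s <̇ t)  ρ ξ = ⟦ s ⟧ ρ <ᴹ ⟦ t ⟧ ρ
  Sat (t ∈̇ X)  ρ ξ = ⟦ t ⟧ ρ ∈ᴹ lookup ξ X
  Sat (¬̇ φ)    ρ ξ = ¬ Sat φ ρ ξ
  Sat (φ ∧̇ ψ)  ρ ξ = Sat φ ρ ξ × Sat ψ ρ ξ
  Sat (φ ∨̇ ψ)  ρ ξ = Sat φ ρ ξ ⊎ Sat ψ ρ ξ
  Sat (φ ⇒ ψ)  ρ ξ = Sat φ ρ ξ → Sat ψ ρ ξ
  Sat (∀̇ φ)    ρ ξ = (a : 𝔻) → Sat φ (a ∷ ρ) ξ
  Sat (∃̇ φ)    ρ ξ = Σ[ a ∈ 𝔻 ] Sat φ (a ∷ ρ) ξ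
  Sat (∀² φ)   ρ ξ = (A : 𝕊) → Sat φ ρ (A ∷ ξ)
  Sat (∃² φ)   ρ ξ = Σ[ A ∈ 𝕊 ] Sat φ ρ (A ∷ ξ)

  -- Truth of the universal closure.
  Valid : Formula n m → Set ℓ
  Valid φ = ∀ ρ ξ → Sat φ ρ ξ

  -- The object logic is classical while Agda is not, so two-valuedness of
  -- satisfaction is part of being a model; given excluded middle in the
  -- metatheory every structure has this property.
  Classical : Set ℓ
  Classical = ∀ {n m} (φ : Formula n m) ρ ξ → Dec (Sat φ ρ ξ)

-- Axioms may have free variables, read as universally quantified.
Theory : Set₁
Theory = ∀ {n m} → Formula n m → Set

record _IsModelOf_ {ℓ : Level} (M : Structure ℓ) (T : Theory) : Set ℓ where
  field
    classical : Classical M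
    axioms    : ∀ {n m} {φ : Formula n m} → T φ → Valid M φ

-- Logical consequence. Soundness and completeness for Henkin semantics
-- identify T ⊨ φ with derivability of φ from T.
Consequence : (ℓ : Level) → Theory → Sentence → Set (lsuc ℓ)
Consequence ℓ T φ = (M : Structure ℓ) → M IsModelOf T → Sat M φ [] []

syntax Consequence ℓ T φ = T ⊨[ ℓ ] φ

-- Bounded quantifier formulas; set parameters are allowed. The weakening
-- of t says that the bound does not mention the bound variable.
data Δ⁰₀ {m : ℕ} : {n : ℕ} → Formula n m → Set where
  eq  : (s t : Term n) → Δ⁰₀ (s ≐ t)
  lt  : (s t : Term n) → Δ⁰₀ (s <̇ t)
  mem : (t : Term n) (X : Fin m) → Δ⁰₀ (t ∈̇ X)
  neg : {φ : Formula n m} → Δ⁰₀ φ → Δ⁰₀ (¬̇ φ)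
  and : {φ ψ : Formula n m} → Δ⁰₀ φ → Δ⁰₀ ψ → Δ⁰₀ (φ ∧̇ ψ)
  or  : {φ ψ : Formula n m} → Δ⁰₀ φ → Δ⁰₀ ψ → Δ⁰₀ (φ ∨̇ ψ)
  imp : {φ ψ : Formula n m} → Δ⁰₀ φ → Δ⁰₀ ψ → Δ⁰₀ (φ ⇒ ψ)
  all : (t : Term n) {φ : Formula (suc n) m} →
        Δ⁰₀ φ → Δ⁰₀ (∀̇ (x₀ <̇ wkTerm t ⇒ φ))
  ex  : (t : Term n) {φ : Formula (suc n) m} →
        Δ⁰₀ φ → Δ⁰₀ (∃̇ (x₀ <̇ wkTerm t ∧̇ φ))

data Σ⁰₁ {n m : ℕ} : Formula n m → Set where
  ex : {θ : Formula (suc n) m} → Δ⁰₀ θ → Σ⁰₁ (∃̇ θ)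

data Π⁰₁ {n m : ℕ} : Formula n m → Set where
  all : {θ : Formula (suc n) m} → Δ⁰₀ θ → Π⁰₁ (∀̇ θ)

data RCA₀ : Theory where
  suc≢0    : RCA₀ {1} {0} (¬̇ (x₀ +̇ 1̇ ≐ 0̇))
  suc-inj  : RCA₀ {2} {0} (x₀ +̇ 1̇ ≐ x₁ +̇ 1̇ ⇒ x₀ ≐ x₁)
  +-zero   : RCA₀ {1} {0} (x₀ +̇ 0̇ ≐ x₀)
  +-suc    : RCA₀ {2} {0} (x₀ +̇ (x₁ +̇ 1̇) ≐ (x₀ +̇ x₁) +̇ 1̇)
  ·-zero   : RCA₀ {1} {0} (x₀ ·̇ 0̇ ≐ 0̇)
  ·-suc    : RCA₀ {2} {0} (x₀ ·̇ (x₁ +̇ 1̇) ≐ x₀ ·̇ x₁ +̇ x₀)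
  ≮0       : RCA₀ {1} {0} (¬̇ (x₀ <̇ 0̇))
  <-suc    : RCA₀ {2} {0} (x₀ <̇ x₁ +̇ 1̇ ⇔ (x₀ <̇ x₁ ∨̇ x₀ ≐ x₁))
  Σ⁰₁-induction : {φ : Formula (suc n) m} → Σ⁰₁ φ →
    RCA₀ (atZero φ ∧̇ (∀̇ (φ ⇒ atSuc φ)) ⇒ (∀̇ φ))
  Δ⁰₁-comprehension : {φ ψ : Formula (suc n) m} → Σ⁰₁ φ → Π⁰₁ ψ →
    RCA₀ ((∀̇ (φ ⇔ ψ)) ⇒ (∃² ∀̇ (x₀ ∈̇ X₀ ⇔ wkSet φ)))

-- The pairing function (i , j) ↦ (i + j)² + i. It is injective but not
-- surjective, hence the clauses below requiring elements to be pairs.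
⟪_,_⟫ : Term n → Term n → Term n
⟪ s , t ⟫ = (s +̇ t) ·̇ (s +̇ t) +̇ s

_∋⟨_,_⟩ : Fin m → Term n → Term n → Formula n m
R ∋⟨ s , t ⟩ = ⟪ s , t ⟫ ∈̇ R

BinaryRelation : Fin m → Formula n m
BinaryRelation R = ∀̇ (x₀ ∈̇ R ⇒ (∃̇ ∃̇ (x₂ ≐ ⟪ x₁ , x₀ ⟫)))

Infinite : Fin m → Formula n m
Infinite S = ∀̇ ∃̇ (x₁ <̇ x₀ ∧̇ x₀ ∈̇ S)

Tournament : Fin m → Formula n m
Tournament T =
  BinaryRelation T ∧̇
  (∀̇ (¬̇ (T ∋⟨ x₀ , x₀ ⟩))) ∧̇
  (∀̇ ∀̇ (¬̇ (x₁ ≐ x₀) ⇒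
    (T ∋⟨ x₁ , x₀ ⟩ ∧̇ ¬̇ (T ∋⟨ x₀ , x₁ ⟩)) ∨̇
    (¬̇ (T ∋⟨ x₁ , x₀ ⟩) ∧̇ T ∋⟨ x₀ , x₁ ⟩)))

-- x = x₂, y = x₁, z = x₀ in the innermost scope
StableRelation : Fin m → Formula n m
StableRelation R =
  ∀̇ ∃̇ ((∀̇ (x₁ <̇ x₀ ⇒ R ∋⟨ x₂ , x₀ ⟩)) ∨̇
        (∀̇ (x₁ <̇ x₀ ⇒ R ∋⟨ x₀ , x₂ ⟩)))

TransitiveOn : (R S : Fin m) → Formula n m
TransitiveOn R S =
  ∀̇ ∀̇ ∀̇ (x₂ ∈̇ S ∧̇ x₁ ∈̇ S ∧̇ x₀ ∈̇ S ⇒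
           R ∋⟨ x₂ , x₁ ⟩ ∧̇ R ∋⟨ x₁ , x₀ ⟩ ⇒ R ∋⟨ x₂ , x₀ ⟩)

SEM : Sentence
SEM = ∀² (Tournament X₀ ∧̇ StableRelation X₀ ⇒
          (∃² (Infinite X₀ ∧̇ TransitiveOn X₁ X₀)))

-- A strict linear order on all of ℕ, hence automatically infinite.
LinearOrder : Fin m → Formula n m
LinearOrder L =
  BinaryRelation L ∧̇
  (∀̇ (¬̇ (L ∋⟨ x₀ , x₀ ⟩))) ∧̇
  (∀̇ ∀̇ ∀̇ (L ∋⟨ x₂ , x₁ ⟩ ∧̇ L ∋⟨ x₁ , x₀ ⟩ ⇒ L ∋⟨ x₂ , x₀ ⟩)) ∧̇
  (∀̇ ∀̇ (L ∋⟨ x₁ , x₀ ⟩ ∨̇ x₁ ≐ x₀ ∨̇ L ∋⟨ x₀ , x₁ ⟩))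

-- f is (the graph of) a function ℕ → ℕ.
Function : Fin m → Formula n m
Function f =
  BinaryRelation f ∧̇
  (∀̇ ∃̇ (f ∋⟨ x₁ , x₀ ⟩)) ∧̇
  (∀̇ ∀̇ ∀̇ (f ∋⟨ x₂ , x₁ ⟩ ∧̇ f ∋⟨ x₂ , x₀ ⟩ ⇒ x₁ ≐ x₀))

-- Arguments x₃ < x₂ with values f(x₃) = x₁ and f(x₂) = x₀.
Ascending Descending : (f L : Fin m) → Formula n m
Ascending f L =
  ∀̇ ∀̇ ∀̇ ∀̇ (x₃ <̇ x₂ ∧̇ f ∋⟨ x₃ , x₁ ⟩ ∧̇ f ∋⟨ x₂ , x₀ ⟩ ⇒ L ∋⟨ x₁ , x₀ ⟩)
Descending f L =
  ∀̇ ∀̇ ∀̇ ∀̇ (x₃ <̇ x₂ ∧̇ f ∋⟨ x₃ , x₁ ⟩ ∧̇ f ∋⟨ x₂ , x₀ ⟩ ⇒ L ∋⟨ x₀ , x₁ ⟩)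

SADS : Sentence
SADS = ∀² (LinearOrder X₀ ∧̇ StableRelation X₀ ⇒
           (∃² (Function X₀ ∧̇ (Ascending X₀ X₁ ∨̇ Descending X₀ X₁))))

IsColor : Term n → Formula n m
IsColor t = t ≐ 0̇ ∨̇ t ≐ 1̇

-- c(s , t) = i
Color : Fin m → (s t i : Term n) → Formula n m
Color c s t i = c ∋⟨ ⟪ s , t ⟫ , i ⟩

-- The set c is the graph of a function [ℕ]² → {0,1}, an element {x , y} of
-- [ℕ]² with x < y being represented by the pair (x , y).
Coloring : Fin m → Formula n m
Coloring c =
  (∀̇ (x₀ ∈̇ c ⇒
    (∃̇ ∃̇ ∃̇ (x₃ ≐ ⟪ ⟪ x₂ , x₁ ⟫ , x₀ ⟫ ∧̇ x₂ <̇ x₁ ∧̇ IsColor x₀)))) ∧̇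
  (∀̇ ∀̇ (x₁ <̇ x₀ ⇒ (∃̇ Color c x₂ x₁ x₀))) ∧̇
  (∀̇ ∀̇ ∀̇ ∀̇ (Color c x₃ x₂ x₁ ∧̇ Color c x₃ x₂ x₀ ⇒ x₁ ≐ x₀))

-- In the innermost scope: n = x₃, its limit color x₂, the bound x₁, y = x₀.
StableColoring : Fin m → Formula n m
StableColoring c =
  ∀̇ ∃̇ (IsColor x₀ ∧̇
        (∃̇ ∀̇ (x₁ <̇ x₀ ∧̇ x₃ <̇ x₀ ⇒ Color c x₃ x₀ x₂)))

Homogeneous : (c H : Fin m) → Formula n m
Homogeneous c H =
  ∃̇ (IsColor x₀ ∧̇
     (∀̇ ∀̇ (x₁ ∈̇ H ∧̇ x₀ ∈̇ H ∧̇ x₁ <̇ x₀ ⇒ Color c x₁ x₀ x₂)))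

SRT²₂ : Sentence
SRT²₂ = ∀² (Coloring X₀ ∧̇ StableColoring X₀ ⇒
            (∃² (Infinite X₀ ∧̇ Homogeneous X₁ X₀)))

{-# OPTIONS --safe #-}
module Submission where

-- A stable coloring c gives a stable tournament T, in which x < y is oriented
-- x → y or y → x according to c(x , y). On an infinite transitive S the tournament
-- is a linear order; pulling it back along p(x) = max (S ∩ [0 , x + s₀]), with
-- s₀ ∈ S and ties broken by <, makes it a stable linear order on all of ℕ that is
-- definable with bounded quantifiers, so S need not be enumerated by recursion.
-- If f is a monotone sequence for it, the values p(f(n)) exceeding all earlier
-- ones form a homogeneous set; this set is Δ⁰₁, and it is infinite because f is
-- injective and hence unbounded. The latter is the pigeonhole principle, proved by
-- Σ⁰₁-induction with finite sets coded as products of pairwise coprime moduli.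

open import Algebra.Bundles using (CommutativeSemiring)
open import Algebra.Structures.Biased using (isCommutativeSemiringˡ)
open import Data.Empty using (⊥-elim)
open import Data.Fin.Base using (Fin; zero; suc)
open import Data.Nat.Base using (ℕ; suc)
open import Data.Product using (Σ-syntax; _×_; _,_; proj₁; proj₂)
open import Data.Product.Function.NonDependent.Propositional using (_×-⇔_)
open import Data.Sum using (_⊎_; inj₁; inj₂)
open import Data.Sum.Function.Propositional using (_⊎-⇔_)
open import Data.Vec.Base using (Vec; []; _∷_; lookup)
open import Function.Base using (id; _∘_; case_of_)
open import Function.Bundles using (mk⇔; module Equivalence) renaming (_⇔_ to _⟷_)
open import Function.Related.TypeIsomorphisms using (→-cong-⇔; ¬-cong-⇔)
open import Level using (Level)
open import Relation.Binary.PropositionalEquality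
open import Relation.Nullary using (Dec; yes; no; ¬_; contradiction)
open import Defs

open Equivalence using (to; from)

private
  variable
    n n′ m m′ : ℕ

-- Bounded formulas and their substitution instances.

pattern x₄ = var (suc (suc (suc (suc zero))))
pattern x₅ = var (suc (suc (suc (suc (suc zero)))))

-- Non-strict bounds appear as strict bounds on a successor. With `b` read as `x + s₀` the formula
-- unfolds to `Floor x s`.
maximumUpTo : (X : Fin m) (b s : Term n) → Formula n m
maximumUpTo X b s =
  s ∈̇ X ∧̇ s <̇ b +̇ 1̇ ∧̇ (∀̇ (x₀ <̇ wkTerm (b +̇ 1̇) ⇒ x₀ ∈̇ X ⇒ x₀ <̇ wkTerm s +̇ 1̇))

Δ⁰₀-maximumUpTo : (X : Fin m) (b s : Term n) → Δ⁰₀ (maximumUpTo X b s)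
Δ⁰₀-maximumUpTo X b s =
  and (mem s X) (and (lt s (b +̇ 1̇))
    (all (b +̇ 1̇) (imp (mem x₀ X) (lt x₀ (wkTerm s +̇ 1̇)))))

-- That the value lies below `y` follows from its sum with `k` doing so; stating it separately makes
-- the inner quantifier bounded.
valuesBelow : (f : Fin m) (k n y : Term n′) → Formula n′ m
valuesBelow f k n y =
  ∀̇ (x₀ <̇ wkTerm n ⇒
    (∃̇ (x₀ <̇ wkTerm (wkTerm y) ∧̇
        f ∋⟨ x₁ , x₀ ⟩ ∧̇ x₀ +̇ wkTerm (wkTerm k) <̇ wkTerm (wkTerm y))))

Δ⁰₀-valuesBelow : (f : Fin m) (k n y : Term n′) → Δ⁰₀ (valuesBelow f k n y)
Δ⁰₀-valuesBelow f k n y =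
  all n (ex (wkTerm y)
    (and (mem ⟪ x₁ , x₀ ⟫ f) (lt (x₀ +̇ wkTerm (wkTerm k)) (wkTerm (wkTerm y)))))

-- Bounded quantifiers need a bound of the form `wkTerm t`; this restores that form after a
-- substitution under the binder.
subTerm-wk : (σ : Fin n → Term n′) (t : Term n) →
             subTerm (liftSub σ) (wkTerm t) ≡ wkTerm (subTerm σ t)
subTerm-wk σ (var i) = refl
subTerm-wk σ 0̇       = refl
subTerm-wk σ 1̇       = refl
subTerm-wk σ (s +̇ t) = cong₂ _+̇_ (subTerm-wk σ s) (subTerm-wk σ t)
subTerm-wk σ (s ·̇ t) = cong₂ _·̇_ (subTerm-wk σ s) (subTerm-wk σ t)

Δ⁰₀-sub : (σ : Fin n → Term n′) (τ : Fin m → Fin m′) {φ : Formula n m} →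
          Δ⁰₀ φ → Δ⁰₀ (sub σ τ φ)
Δ⁰₀-sub σ τ (eq s t)  = eq (subTerm σ s) (subTerm σ t)
Δ⁰₀-sub σ τ (lt s t)  = lt (subTerm σ s) (subTerm σ t)
Δ⁰₀-sub σ τ (mem t X) = mem (subTerm σ t) (τ X)
Δ⁰₀-sub σ τ (neg φ)   = neg (Δ⁰₀-sub σ τ φ)
Δ⁰₀-sub σ τ (and φ ψ) = and (Δ⁰₀-sub σ τ φ) (Δ⁰₀-sub σ τ ψ)
Δ⁰₀-sub σ τ (or φ ψ)  = or (Δ⁰₀-sub σ τ φ) (Δ⁰₀-sub σ τ ψ)
Δ⁰₀-sub σ τ (imp φ ψ) = imp (Δ⁰₀-sub σ τ φ) (Δ⁰₀-sub σ τ ψ)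
Δ⁰₀-sub σ τ (all t φ) =
  subst (λ s → Δ⁰₀ (∀̇ (x₀ <̇ s ⇒ _))) (sym (subTerm-wk σ t))
        (all (subTerm σ t) (Δ⁰₀-sub (liftSub σ) τ φ))
Δ⁰₀-sub σ τ (ex t φ)  =
  subst (λ s → Δ⁰₀ (∃̇ (x₀ <̇ s ∧̇ _))) (sym (subTerm-wk σ t))
        (ex (subTerm σ t) (Δ⁰₀-sub (liftSub σ) τ φ))

-- The substitution lemma for satisfaction.

module Substitution {ℓ : Level} (M : Structure ℓ) where
  open Structure M

  ⟦⟧-sub : (σ : Fin n → Term n′) (t : Term n) {ρ : Vec 𝔻 n′} {ρ′ : Vec 𝔻 n} →
           (∀ i → ⟦_⟧ M (σ i) ρ ≡ lookup ρ′ i) →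
           ⟦_⟧ M (subTerm σ t) ρ ≡ ⟦_⟧ M t ρ′
  ⟦⟧-sub σ (var i) e = e i
  ⟦⟧-sub σ 0̇       e = refl
  ⟦⟧-sub σ 1̇       e = refl
  ⟦⟧-sub σ (s +̇ t) e = cong₂ _+ᴹ_ (⟦⟧-sub σ s e) (⟦⟧-sub σ t e)
  ⟦⟧-sub σ (s ·̇ t) e = cong₂ _·ᴹ_ (⟦⟧-sub σ s e) (⟦⟧-sub σ t e)

  ⟦⟧-liftSub : (σ : Fin n → Term n′) {ρ : Vec 𝔻 n′} {ρ′ : Vec 𝔻 n} →
               (∀ i → ⟦_⟧ M (σ i) ρ ≡ lookup ρ′ i) →
               ∀ a i → ⟦_⟧ M (liftSub σ i) (a ∷ ρ) ≡ lookup (a ∷ ρ′) i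
  ⟦⟧-liftSub σ e a zero    = refl
  ⟦⟧-liftSub σ e a (suc i) =
    trans (⟦⟧-sub (λ j → var (suc j)) (σ i) (λ _ → refl)) (e i)

  lookup-liftRen : (τ : Fin m → Fin m′) {ξ : Vec 𝕊 m′} {ξ′ : Vec 𝕊 m} →
                   (∀ X → lookup ξ (τ X) ≡ lookup ξ′ X) →
                   ∀ A X → lookup (A ∷ ξ) (liftRen τ X) ≡ lookup (A ∷ ξ′) X
  lookup-liftRen τ e A zero    = refl
  lookup-liftRen τ e A (suc X) = e X

  ≡⇒⟷ : {A B : Set ℓ} → A ≡ B → A ⟷ B
  ≡⇒⟷ refl = mk⇔ id id

  -- The environments `ρ′` and `ξ′` are only required to agree pointwise with the substitution, so
  -- the induction passes under a binder by extending both sides with the same element.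
  Sat-sub : (φ : Formula n m) (σ : Fin n → Term n′) (τ : Fin m → Fin m′)
            {ρ : Vec 𝔻 n′} {ρ′ : Vec 𝔻 n} {ξ : Vec 𝕊 m′} {ξ′ : Vec 𝕊 m} →
            (∀ i → ⟦_⟧ M (σ i) ρ ≡ lookup ρ′ i) →
            (∀ X → lookup ξ (τ X) ≡ lookup ξ′ X) →
            Sat M (sub σ τ φ) ρ ξ ⟷ Sat M φ ρ′ ξ′
  Sat-sub (s ≐ t) σ τ e f = ≡⇒⟷ (cong₂ _≡_ (⟦⟧-sub σ s e) (⟦⟧-sub σ t e))
  Sat-sub (s <̇ t) σ τ e f = ≡⇒⟷ (cong₂ _<ᴹ_ (⟦⟧-sub σ s e) (⟦⟧-sub σ t e))
  Sat-sub (t ∈̇ X) σ τ e f = ≡⇒⟷ (cong₂ _∈ᴹ_ (⟦⟧-sub σ t e) (f X))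
  Sat-sub (¬̇ φ)   σ τ e f = ¬-cong-⇔ (Sat-sub φ σ τ e f)
  Sat-sub (φ ∧̇ ψ) σ τ e f = Sat-sub φ σ τ e f ×-⇔ Sat-sub ψ σ τ e f
  Sat-sub (φ ∨̇ ψ) σ τ e f = Sat-sub φ σ τ e f ⊎-⇔ Sat-sub ψ σ τ e f
  Sat-sub (φ ⇒ ψ) σ τ e f = →-cong-⇔ (Sat-sub φ σ τ e f) (Sat-sub ψ σ τ e f)
  Sat-sub (∀̇ φ)   σ τ e f = mk⇔ (λ h a → to (ih a) (h a)) (λ h a → from (ih a) (h a))
    where ih = λ a → Sat-sub φ (liftSub σ) τ (⟦⟧-liftSub σ e a) f
  Sat-sub (∃̇ φ)   σ τ e f = mk⇔ (λ (a , h) → a , to (ih a) h) (λ (a , h) → a , from (ih a) h)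
    where ih = λ a → Sat-sub φ (liftSub σ) τ (⟦⟧-liftSub σ e a) f
  Sat-sub (∀² φ)  σ τ e f = mk⇔ (λ h A → to (ih A) (h A)) (λ h A → from (ih A) (h A))
    where ih = λ A → Sat-sub φ σ (liftRen τ) e (lookup-liftRen τ f A)
  Sat-sub (∃² φ)  σ τ e f = mk⇔ (λ (A , h) → A , to (ih A) h) (λ (A , h) → A , from (ih A) h)
    where ih = λ A → Sat-sub φ σ (liftRen τ) e (lookup-liftRen τ f A)

-- Induction and comprehension in a model of `RCA₀`.

module Arithmetic {ℓ : Level} (M : Structure ℓ) (isModel : M IsModelOf RCA₀) where
  open Structure M renaming
    ( zeroᴹ to 0#; oneᴹ to 1#; _+ᴹ_ to infixl 6 _+_; _·ᴹ_ to infixl 7 _*_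
    ; _<ᴹ_ to infix 4 _<_; _∈ᴹ_ to infix 4 _∈_ ) public
  open _IsModelOf_ isModel public
  open Substitution M

  infix 4 _≤_ _∣_

  Sat-wk : (φ : Formula n m) {a : 𝔻} {ρ : Vec 𝔻 n} {ξ : Vec 𝕊 m} →
           Sat M (sub (λ i → var (suc i)) id φ) (a ∷ ρ) ξ ⟷ Sat M φ ρ ξ
  Sat-wk φ = Sat-sub φ _ _ (λ _ → refl) (λ _ → refl)

  Σ⁰₁-ind : {φ : Formula (suc n) m} → Σ⁰₁ φ → ∀ ρ ξ →
            Sat M φ (0# ∷ ρ) ξ →
            (∀ a → Sat M φ (a ∷ ρ) ξ → Sat M φ (a + 1# ∷ ρ) ξ) →
            ∀ a → Sat M φ (a ∷ ρ) ξ
  Σ⁰₁-ind {φ = φ} Σφ ρ ξ base step =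
    axioms (Σ⁰₁-induction Σφ) ρ ξ
      ( from (Sat-sub φ _ _ (λ { zero → refl ; (suc _) → refl }) (λ _ → refl)) base
      , λ a h → from (Sat-sub φ _ _ (λ { zero → refl ; (suc _) → refl }) (λ _ → refl))
                     (step a h) )

  -- A vacuous existential quantifier, always witnessed by `0#`, makes the bounded formula Σ⁰₁.
  Δ⁰₀-ind : {φ : Formula (suc n) m} → Δ⁰₀ φ → ∀ ρ ξ →
            Sat M φ (0# ∷ ρ) ξ →
            (∀ a → Sat M φ (a ∷ ρ) ξ → Sat M φ (a + 1# ∷ ρ) ξ) →
            ∀ a → Sat M φ (a ∷ ρ) ξ
  Δ⁰₀-ind {φ = φ} Δφ ρ ξ base step a =
    to (Sat-wk φ) (proj₂ (Σ⁰₁-ind (ex (Δ⁰₀-sub _ id Δφ)) ρ ξ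
      (0# , from (Sat-wk φ) base)
      (λ b (_ , h) → 0# , from (Sat-wk φ) (step b (to (Sat-wk φ) h))) a))

  Δ⁰₁-comp : {φ ψ : Formula (suc n) m} → Σ⁰₁ φ → Π⁰₁ ψ → ∀ ρ ξ →
             (∀ a → Sat M φ (a ∷ ρ) ξ ⟷ Sat M ψ (a ∷ ρ) ξ) →
             Σ[ A ∈ 𝕊 ] (∀ a → a ∈ A ⟷ Sat M φ (a ∷ ρ) ξ)
  Δ⁰₁-comp {φ = φ} Σφ Πψ ρ ξ φ⟷ψ
    with A , h ← axioms (Δ⁰₁-comprehension Σφ Πψ) ρ ξ (λ a → to (φ⟷ψ a) , from (φ⟷ψ a)) =
    A , λ a → mk⇔ (to (wk a) ∘ proj₁ (h a)) (proj₂ (h a) ∘ from (wk a))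
    where
    wk : ∀ {A} a → Sat M (wkSet φ) (a ∷ ρ) (A ∷ ξ) ⟷ Sat M φ (a ∷ ρ) ξ
    wk a = Sat-sub φ _ _ (λ _ → refl) (λ _ → refl)

  -- Vacuous quantifiers of both kinds turn one bounded formula into the Σ⁰₁ and the Π⁰₁ definition
  -- that comprehension asks for.
  Δ⁰₀-comp : {φ : Formula (suc n) m} → Δ⁰₀ φ → ∀ ρ ξ →
             Σ[ A ∈ 𝕊 ] (∀ a → a ∈ A ⟷ Sat M φ (a ∷ ρ) ξ)
  Δ⁰₀-comp {φ = φ} Δφ ρ ξ
    with A , h ← Δ⁰₁-comp (ex (Δ⁰₀-sub _ id Δφ)) (all (Δ⁰₀-sub _ id Δφ)) ρ ξ
                   (λ a → mk⇔ (λ (_ , s) _ → from (Sat-wk φ) (to (Sat-wk φ) s))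
                              (λ s → 0# , s 0#)) =
    A , λ a → mk⇔ (λ a∈A → to (Sat-wk φ) (proj₂ (to (h a) a∈A)))
                  (λ s → from (h a) (0# , from (Sat-wk φ) s))

  -- Commutative semiring laws.

  +-identityʳ : ∀ x → x + 0# ≡ x
  +-identityʳ x = axioms +-zero (x ∷ []) []

  +-sucʳ : ∀ x y → x + (y + 1#) ≡ x + y + 1#
  +-sucʳ x y = axioms +-suc (x ∷ y ∷ []) []

  *-zeroʳ : ∀ x → x * 0# ≡ 0#
  *-zeroʳ x = axioms ·-zero (x ∷ []) []

  *-sucʳ : ∀ x y → x * (y + 1#) ≡ x * y + x
  *-sucʳ x y = axioms ·-suc (x ∷ y ∷ []) []

  x+1≢0 : ∀ {x} → x + 1# ≢ 0#
  x+1≢0 {x} = axioms suc≢0 (x ∷ []) []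

  +1-injective : ∀ {x y} → x + 1# ≡ y + 1# → x ≡ y
  +1-injective {x} {y} = axioms suc-inj (x ∷ y ∷ []) []

  +-identityˡ : ∀ x → 0# + x ≡ x
  +-identityˡ = Δ⁰₀-ind (eq (0̇ +̇ x₀) x₀) [] [] (+-identityʳ 0#)
    (λ x ih → trans (+-sucʳ 0# x) (cong (_+ 1#) ih))

  +-assoc : ∀ x y z → x + y + z ≡ x + (y + z)
  +-assoc x y = Δ⁰₀-ind (eq (x₁ +̇ x₂ +̇ x₀) (x₁ +̇ (x₂ +̇ x₀))) (x ∷ y ∷ []) []
    (trans (+-identityʳ (x + y)) (cong (x +_) (sym (+-identityʳ y))))
    (λ z ih → begin
      x + y + (z + 1#)     ≡⟨ +-sucʳ (x + y) z ⟩
      x + y + z + 1#       ≡⟨ cong (_+ 1#) ih ⟩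
      x + (y + z) + 1#     ≡⟨ +-sucʳ x (y + z) ⟨
      x + (y + z + 1#)     ≡⟨ cong (x +_) (+-sucʳ y z) ⟨
      x + (y + (z + 1#))   ∎)
    where open ≡-Reasoning

  1+x≡x+1 : ∀ x → 1# + x ≡ x + 1#
  1+x≡x+1 = Δ⁰₀-ind (eq (1̇ +̇ x₀) (x₀ +̇ 1̇)) [] []
    (trans (+-identityʳ 1#) (sym (+-identityˡ 1#)))
    (λ x ih → trans (+-sucʳ 1# x) (cong (_+ 1#) ih))

  +-comm : ∀ x y → x + y ≡ y + x
  +-comm x = Δ⁰₀-ind (eq (x₁ +̇ x₀) (x₀ +̇ x₁)) (x ∷ []) []
    (trans (+-identityʳ x) (sym (+-identityˡ x)))
    (λ y ih → begin
      x + (y + 1#)   ≡⟨ +-sucʳ x y ⟩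
      x + y + 1#     ≡⟨ cong (_+ 1#) ih ⟩
      y + x + 1#     ≡⟨ +-assoc y x 1# ⟩
      y + (x + 1#)   ≡⟨ cong (y +_) (1+x≡x+1 x) ⟨
      y + (1# + x)   ≡⟨ +-assoc y 1# x ⟨
      y + 1# + x     ∎)
    where open ≡-Reasoning

  +-swap-middle : ∀ a b c d → (a + b) + (c + d) ≡ (a + c) + (b + d)
  +-swap-middle a b c d = begin
    (a + b) + (c + d)   ≡⟨ +-assoc a b (c + d) ⟩
    a + (b + (c + d))   ≡⟨ cong (a +_) (+-assoc b c d) ⟨
    a + (b + c + d)     ≡⟨ cong (λ t → a + (t + d)) (+-comm b c) ⟩
    a + (c + b + d)     ≡⟨ cong (a +_) (+-assoc c b d) ⟩
    a + (c + (b + d))   ≡⟨ +-assoc a c (b + d) ⟨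
    (a + c) + (b + d)   ∎
    where open ≡-Reasoning

  *-zeroˡ : ∀ x → 0# * x ≡ 0#
  *-zeroˡ = Δ⁰₀-ind (eq (0̇ ·̇ x₀) 0̇) [] [] (*-zeroʳ 0#)
    (λ x ih → trans (*-sucʳ 0# x) (trans (+-identityʳ (0# * x)) ih))

  *-distribʳ : ∀ z x y → (x + y) * z ≡ x * z + y * z
  *-distribʳ z x y = Δ⁰₀-ind (eq ((x₁ +̇ x₂) ·̇ x₀) (x₁ ·̇ x₀ +̇ x₂ ·̇ x₀)) (x ∷ y ∷ []) []
    (trans (*-zeroʳ (x + y))
      (sym (trans (cong₂ _+_ (*-zeroʳ x) (*-zeroʳ y)) (+-identityʳ 0#))))
    (λ z ih → begin
      (x + y) * (z + 1#)                ≡⟨ *-sucʳ (x + y) z ⟩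
      (x + y) * z + (x + y)             ≡⟨ cong (_+ (x + y)) ih ⟩
      (x * z + y * z) + (x + y)         ≡⟨ +-swap-middle (x * z) (y * z) x y ⟩
      (x * z + x) + (y * z + y)         ≡⟨ cong₂ _+_ (*-sucʳ x z) (*-sucʳ y z) ⟨
      x * (z + 1#) + y * (z + 1#)       ∎)
    z
    where open ≡-Reasoning

  *-identityʳ : ∀ x → x * 1# ≡ x
  *-identityʳ x = begin
    x * 1#          ≡⟨ cong (x *_) (+-identityˡ 1#) ⟨
    x * (0# + 1#)   ≡⟨ *-sucʳ x 0# ⟩
    x * 0# + x      ≡⟨ cong (_+ x) (*-zeroʳ x) ⟩
    0# + x          ≡⟨ +-identityˡ x ⟩
    x               ∎
    where open ≡-Reasoning

  *-identityˡ : ∀ x → 1# * x ≡ x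
  *-identityˡ = Δ⁰₀-ind (eq (1̇ ·̇ x₀) x₀) [] [] (*-zeroʳ 1#)
    (λ x ih → trans (*-sucʳ 1# x) (cong (_+ 1#) ih))

  *-comm : ∀ x y → x * y ≡ y * x
  *-comm x = Δ⁰₀-ind (eq (x₁ ·̇ x₀) (x₀ ·̇ x₁)) (x ∷ []) []
    (trans (*-zeroʳ x) (sym (*-zeroˡ x)))
    (λ y ih → begin
      x * (y + 1#)     ≡⟨ *-sucʳ x y ⟩
      x * y + x        ≡⟨ cong₂ _+_ ih (sym (*-identityˡ x)) ⟩
      y * x + 1# * x   ≡⟨ *-distribʳ x y 1# ⟨
      (y + 1#) * x     ∎)
    where open ≡-Reasoning

  *-distribˡ : ∀ x y z → x * (y + z) ≡ x * y + x * z
  *-distribˡ x y z =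
    trans (*-comm x (y + z)) (trans (*-distribʳ x y z) (cong₂ _+_ (*-comm y x) (*-comm z x)))

  *-assoc : ∀ x y z → x * y * z ≡ x * (y * z)
  *-assoc x y = Δ⁰₀-ind (eq (x₁ ·̇ x₂ ·̇ x₀) (x₁ ·̇ (x₂ ·̇ x₀))) (x ∷ y ∷ []) []
    (trans (*-zeroʳ (x * y)) (sym (trans (cong (x *_) (*-zeroʳ y)) (*-zeroʳ x))))
    (λ z ih → begin
      x * y * (z + 1#)         ≡⟨ *-sucʳ (x * y) z ⟩
      x * y * z + x * y        ≡⟨ cong (_+ x * y) ih ⟩
      x * (y * z) + x * y      ≡⟨ *-distribˡ x (y * z) y ⟨
      x * (y * z + y)          ≡⟨ cong (x *_) (*-sucʳ y z) ⟨
      x * (y * (z + 1#))       ∎)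
    where open ≡-Reasoning

  -- Feeds the ring solver, which settles the polynomial identities below. As there is no
  -- subtraction, inequalities are reduced to such identities by exhibiting the difference.
  semiring : CommutativeSemiring ℓ ℓ
  semiring = record
    { isCommutativeSemiring = isCommutativeSemiringˡ record
      { +-isCommutativeMonoid = record
        { isMonoid = record
          { isSemigroup = record
            { isMagma = record { isEquivalence = isEquivalence ; ∙-cong = cong₂ _+_ }
            ; assoc = +-assoc }
          ; identity = +-identityˡ , +-identityʳ }
        ; comm = +-comm }
      ; *-isCommutativeMonoid = record
        { isMonoid = record
          { isSemigroup = record
            { isMagma = record { isEquivalence = isEquivalence ; ∙-cong = cong₂ _*_ }
            ; assoc = *-assoc }
          ; identity = *-identityˡ , *-identityʳ }
        ; comm = *-comm }
      ; distribʳ = *-distribʳ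
      ; zeroˡ = *-zeroˡ
      } }

  open import Algebra.Solver.Ring.NaturalCoefficients.Default semiring public
    using (solve; con; _:+_; _:*_; _:=_)

  -- Order and cancellation.

  _≤_ : 𝔻 → 𝔻 → Set ℓ
  x ≤ y = x < y + 1#

  _∣_ : 𝔻 → 𝔻 → Set ℓ
  x ∣ y = Σ[ q ∈ 𝔻 ] q * x ≡ y

  _<?_ : ∀ x y → Dec (x < y)
  x <? y = classical (x₀ <̇ x₁) (x ∷ y ∷ []) []

  x≮0 : ∀ {x} → ¬ x < 0#
  x≮0 {x} = axioms ≮0 (x ∷ []) []

  ≤⇒<∨≡ : ∀ {x y} → x ≤ y → x < y ⊎ x ≡ y
  ≤⇒<∨≡ {x} {y} = proj₁ (axioms <-suc (x ∷ y ∷ []) [])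

  <⇒≤ : ∀ {x y} → x < y → x ≤ y
  <⇒≤ {x} {y} = proj₂ (axioms <-suc (x ∷ y ∷ []) []) ∘ inj₁

  ≤-refl : ∀ {x} → x ≤ x
  ≤-refl {x} = proj₂ (axioms <-suc (x ∷ x ∷ []) []) (inj₂ refl)

  -- The axioms describe `_<_` only at zero and at successors; induction on `y` recovers the
  -- difference. The implication stands inside the existential so that the induction formula is Σ⁰₁.
  <⇒+ : ∀ {x y} → x < y → Σ[ d ∈ 𝔻 ] x + (d + 1#) ≡ y
  <⇒+ {x} {y} x<y = let (d , h) = difference y in d , h x<y
    where
    difference : ∀ y → Σ[ d ∈ 𝔻 ] (x < y → x + (d + 1#) ≡ y)
    difference = Σ⁰₁-ind (ex (imp (lt x₂ x₁) (eq (x₂ +̇ (x₀ +̇ 1̇)) x₁))) (x ∷ []) []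
      (0# , λ x<0 → contradiction x<0 x≮0) step
      where
      step : ∀ y → Σ[ d ∈ 𝔻 ] (x < y → x + (d + 1#) ≡ y) →
             Σ[ d ∈ 𝔻 ] (x < y + 1# → x + (d + 1#) ≡ y + 1#)
      step y (d , ih) with x <? y
      ... | yes x<y = d + 1# , λ _ → trans (+-sucʳ x (d + 1#)) (cong (_+ 1#) (ih x<y))
      -- Of `x ≤ y` only `x ≡ y` is left here, so `x` and `y + 1#` differ by one.
      ... | no x≮y = 0# , λ x≤y → trans (cong (x +_) (+-identityˡ 1#))
                       (cong (_+ 1#) (equal x≤y))
        where
        equal : x ≤ y → x ≡ y
        equal x≤y with ≤⇒<∨≡ x≤y
        ... | inj₁ x<y = contradiction x<y x≮y
        ... | inj₂ x≡y = x≡y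

  x<x+1+d : ∀ x d → x < x + (d + 1#)
  x<x+1+d x = Δ⁰₀-ind (lt x₁ (x₁ +̇ (x₀ +̇ 1̇))) (x ∷ []) []
    (subst (λ t → x < x + t) (sym (+-identityˡ 1#)) ≤-refl)
    (λ d ih → subst (x <_) (sym (+-sucʳ x (d + 1#))) (<⇒≤ ih))

  +⇒< : ∀ {x y} d → x + (d + 1#) ≡ y → x < y
  +⇒< {x} d refl = x<x+1+d x d

  ≤⇒+ : ∀ {x y} → x ≤ y → Σ[ d ∈ 𝔻 ] x + d ≡ y
  ≤⇒+ {x} x≤y with d , e ← <⇒+ x≤y = d , +1-injective (trans (sym (+-sucʳ x d)) e)

  +⇒≤ : ∀ {x y} d → x + d ≡ y → x ≤ y
  +⇒≤ {x} d refl = +⇒< d (+-sucʳ x d)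

  zero-or-suc : ∀ x → x ≡ 0# ⊎ (Σ[ y ∈ 𝔻 ] x ≡ y + 1#)
  zero-or-suc x = split (proj₂ (Σ⁰₁-ind (ex (or (eq x₁ 0̇) (eq x₁ (x₀ +̇ 1̇)))) [] []
      (0# , inj₁ refl) (λ y _ → y , inj₂ refl) x))
    where
    split : ∀ {y} → x ≡ 0# ⊎ x ≡ y + 1# → x ≡ 0# ⊎ (Σ[ y ∈ 𝔻 ] x ≡ y + 1#)
    split (inj₁ e) = inj₁ e
    split (inj₂ e) = inj₂ (_ , e)

  0≤x : ∀ {x} → 0# ≤ x
  0≤x {x} = +⇒≤ x (+-identityˡ x)

  +-cancelʳ : ∀ x y z → x + z ≡ y + z → x ≡ y
  +-cancelʳ x y = Δ⁰₀-ind (imp (eq (x₁ +̇ x₀) (x₂ +̇ x₀)) (eq x₁ x₂)) (x ∷ y ∷ []) []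
    (λ e → trans (sym (+-identityʳ x)) (trans e (+-identityʳ y)))
    (λ z ih e → ih (+1-injective (trans (sym (+-sucʳ x z)) (trans e (+-sucʳ y z)))))

  +-cancelˡ : ∀ z x y → z + x ≡ z + y → x ≡ y
  +-cancelˡ z x y e = +-cancelʳ x y z (trans (+-comm x z) (trans e (+-comm z y)))

  <-irrefl : ∀ {x} → ¬ x < x
  <-irrefl {x} x<x with d , e ← <⇒+ x<x =
    x+1≢0 (+-cancelˡ x (d + 1#) 0# (trans e (sym (+-identityʳ x))))

  <-≤-trans : ∀ {x y z} → x < y → y ≤ z → x < z
  <-≤-trans {x} x<y y≤z with d , refl ← <⇒+ x<y | e , refl ← ≤⇒+ y≤z =
    +⇒< (d + e) (solve 3 (λ x d e → x :+ (d :+ e :+ con 1) := x :+ (d :+ con 1) :+ e) refl x d e)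

  <-trans : ∀ {x y z} → x < y → y < z → x < z
  <-trans x<y y<z = <-≤-trans x<y (<⇒≤ y<z)

  ≤-<-trans : ∀ {x y z} → x ≤ y → y < z → x < z
  ≤-<-trans {x} x≤y y<z with d , refl ← ≤⇒+ x≤y | e , refl ← <⇒+ y<z =
    +⇒< (d + e) (solve 3 (λ x d e → x :+ (d :+ e :+ con 1) := x :+ d :+ (e :+ con 1)) refl x d e)

  ≤-trans : ∀ {x y z} → x ≤ y → y ≤ z → x ≤ z
  ≤-trans x≤y y≤z = ≤-<-trans x≤y y≤z

  <⇒≱ : ∀ {x y} → x < y → ¬ y ≤ x
  <⇒≱ x<y y≤x = <-irrefl (<-≤-trans x<y y≤x)

  <-asym : ∀ {x y} → x < y → ¬ y < x
  <-asym x<y y<x = <-irrefl (<-trans x<y y<x)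

  <⇒+1≤ : ∀ {x y} → x < y → x + 1# ≤ y
  <⇒+1≤ {x} x<y with d , refl ← <⇒+ x<y =
    +⇒≤ d (solve 2 (λ x d → x :+ con 1 :+ d := x :+ (d :+ con 1)) refl x d)

  data Trichotomy (x y : 𝔻) : Set ℓ where
    less    : x < y → Trichotomy x y
    equal   : x ≡ y → Trichotomy x y
    greater : y < x → Trichotomy x y

  <-cmp : ∀ x y → Trichotomy x y
  <-cmp x y = split (connected x)
    where
    split : x < y ⊎ x ≡ y ⊎ y < x → Trichotomy x y
    split (inj₁ l)        = less l
    split (inj₂ (inj₁ e)) = equal e
    split (inj₂ (inj₂ g)) = greater g

    step : ∀ x → x < y ⊎ x ≡ y ⊎ y < x → x + 1# < y ⊎ x + 1# ≡ y ⊎ y < x + 1#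
    step x (inj₁ x<y) with ≤⇒<∨≡ (<⇒+1≤ x<y)
    ... | inj₁ l = inj₁ l
    ... | inj₂ e = inj₂ (inj₁ e)
    step x (inj₂ (inj₁ refl)) = inj₂ (inj₂ ≤-refl)
    step x (inj₂ (inj₂ y<x))  = inj₂ (inj₂ (<⇒≤ y<x))

    base : 0# < y ⊎ 0# ≡ y ⊎ y < 0#
    base with ≤⇒<∨≡ (0≤x {y})
    ... | inj₁ l = inj₁ l
    ... | inj₂ e = inj₂ (inj₁ e)

    connected : ∀ x → x < y ⊎ x ≡ y ⊎ y < x
    connected = Δ⁰₀-ind (or (lt x₀ x₁) (or (eq x₀ x₁) (lt x₁ x₀))) (y ∷ []) [] base step

  ≮⇒≥ : ∀ {x y} → ¬ x < y → y ≤ x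
  ≮⇒≥ {x} {y} x≮y with <-cmp x y
  ... | less x<y    = contradiction x<y x≮y
  ... | equal refl  = ≤-refl
  ... | greater y<x = <⇒≤ y<x

  ≤-antisym : ∀ {x y} → x ≤ y → y ≤ x → x ≡ y
  ≤-antisym x≤y y≤x with ≤⇒<∨≡ x≤y
  ... | inj₁ x<y = contradiction y≤x (<⇒≱ x<y)
  ... | inj₂ x≡y = x≡y

  x≤x+y : ∀ {x y} → x ≤ x + y
  x≤x+y {y = y} = +⇒≤ y refl

  y≤x+y : ∀ {x y} → y ≤ x + y
  y≤x+y {x} {y} = +⇒≤ x (+-comm y x)

  -- Pairing and comprehension for binary relations.

  pair : 𝔻 → 𝔻 → 𝔻
  pair x y = (x + y) * (x + y) + x

  x≤pair : ∀ x y → x ≤ pair x y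
  x≤pair x y = y≤x+y

  x≤x² : ∀ x → x ≤ x * x
  x≤x² x with zero-or-suc x
  ... | inj₁ refl       = 0≤x
  ... | inj₂ (d , refl) = +⇒≤ (d * d + d)
    (solve 1 (λ d → (d :+ con 1) :+ (d :* d :+ d) := (d :+ con 1) :* (d :+ con 1)) refl d)

  y≤pair : ∀ x y → y ≤ pair x y
  y≤pair x y = ≤-trans y≤x+y (≤-trans (x≤x² (x + y)) x≤x+y)

  -- With s = a + b, the code s² + a is less than (s + 1)² because a ≤ s; codes are therefore
  -- ordered first by their sums.
  pair-mono : ∀ a b c d → a + b < c + d → pair a b < pair c d
  pair-mono a b c d a+b<c+d with e , c+d≡ ← <⇒+ a+b<c+d =
    -- This is `pair c d` minus `pair a b` minus one, expanded with `a + b + (e + 1#)` for `c + d`.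
    +⇒< ((a + b) * e + (a + b) * e + a + b + b + e * e + e + e + c)
      (trans
        (solve 4 (λ a b c e →
            (a :+ b) :* (a :+ b) :+ a
              :+ ((a :+ b) :* e :+ (a :+ b) :* e :+ a :+ b :+ b :+ e :* e :+ e :+ e :+ c :+ con 1)
          := (a :+ b :+ (e :+ con 1)) :* (a :+ b :+ (e :+ con 1)) :+ c)
          refl a b c e)
        (cong (λ s → s * s + c) c+d≡))

  -- Different sums would separate the codes by `pair-mono`; with equal sums the squares cancel.
  pair-injective : ∀ {a b c d} → pair a b ≡ pair c d → a ≡ c × b ≡ d
  pair-injective {a} {b} {c} {d} e with <-cmp (a + b) (c + d)
  ... | less l    = contradiction (subst (pair a b <_) (sym e) (pair-mono a b c d l)) <-irrefl
  ... | greater g = contradiction (subst (pair c d <_) e (pair-mono c d a b g)) <-irrefl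
  ... | equal s   = a≡c , +-cancelˡ c b d (trans (cong (_+ b) (sym a≡c)) s)
    where
    a≡c : a ≡ c
    a≡c = +-cancelˡ _ a c (trans e (cong (λ s → s * s + c) (sym s)))

  collision-free⇒injective : ∀ {f} →
    (∀ {n m v} → n < m → pair n v ∈ f → ¬ pair m v ∈ f) →
    ∀ {n m v} → pair n v ∈ f → pair m v ∈ f → n ≡ m
  collision-free⇒injective distinct {n} {m} nv mv with <-cmp n m
  ... | less n<m    = contradiction mv (distinct n<m nv)
  ... | equal n≡m   = n≡m
  ... | greater m<n = contradiction nv (distinct m<n mv)

  -- Components never exceed the code of their pair, so they can be searched for below it and the
  -- defining formula stays bounded.
  relation-comp : {φ : Formula (suc (suc n)) m} → Δ⁰₀ φ → ∀ ρ ξ →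
                  Σ[ R ∈ 𝕊 ] (∀ q → q ∈ R → Σ[ x ∈ 𝔻 ] Σ[ y ∈ 𝔻 ] q ≡ pair x y) ×
                             (∀ x y → pair x y ∈ R ⟷ Sat M φ (y ∷ x ∷ ρ) ξ)
  relation-comp {n} {φ = φ} Δφ ρ ξ =
    let (R , h) = comp
    in R , (λ q q∈R → let (x , _ , y , _ , e , _) = to (h q) q∈R in x , y , e)
         , λ x y → mk⇔ (to-pair x y ∘ to (h _))
                    (λ s → from (h _) (x , x≤pair x y , y , y≤pair x y , refl , from skip s))
    where
    -- The code sits between the two components and the parameters, so parameter indices move up by
    -- one.
    skipping : Fin (suc (suc n)) → Term (suc (suc (suc n)))
    skipping zero          = x₀
    skipping (suc zero)    = x₁
    skipping (suc (suc i)) = var (suc (suc (suc i)))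

    comp = Δ⁰₀-comp
      (ex (x₀ +̇ 1̇) (ex (x₁ +̇ 1̇) (and (eq x₂ ⟪ x₁ , x₀ ⟫) (Δ⁰₀-sub skipping id Δφ)))) ρ ξ

    skip : ∀ {q x y} → Sat M (sub skipping id φ) (y ∷ x ∷ q ∷ ρ) ξ ⟷ Sat M φ (y ∷ x ∷ ρ) ξ
    skip = Sat-sub φ _ _ (λ { zero → refl ; (suc zero) → refl ; (suc (suc _)) → refl })
                         (λ _ → refl)

    to-pair : ∀ x y → (Σ[ x′ ∈ 𝔻 ] x′ ≤ pair x y × (Σ[ y′ ∈ 𝔻 ] y′ ≤ pair x y ×
                        (pair x y ≡ pair x′ y′ ×
                         Sat M (sub skipping id φ) (y′ ∷ x′ ∷ pair x y ∷ ρ) ξ))) →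
              Sat M φ (y ∷ x ∷ ρ) ξ
    to-pair x y (x′ , _ , y′ , _ , e , s) with refl , refl ← pair-injective e = to skip s

  -- Divisibility, coprime moduli and the pigeonhole principle.

  ∣-*ˡ : ∀ {a x} c → a ∣ x → a ∣ c * x
  ∣-*ˡ {a} c (q , refl) = c * q , *-assoc c q a

  ∣-+-cancelˡ : ∀ {a x y} → a ∣ x → a ∣ x + y → a ∣ y
  ∣-+-cancelˡ {a} {y = y} (k , refl) (l , e) with l <? k
  ... | no l≮k with d , refl ← ≤⇒+ (≮⇒≥ l≮k) =
    d , +-cancelˡ (k * a) (d * a) y (trans (sym (*-distribʳ a k d)) e)
  -- Now `l * a` equals itself plus `(d + 1#) * a + y`, so this remainder is zero, and with it `y`.
  ... | yes l<k with d , refl ← <⇒+ l<k = 0# , trans (*-zeroˡ a) (sym y≡0)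
    where
    rest≡0 : (d + 1#) * a + y ≡ 0#
    rest≡0 = +-cancelˡ (l * a) _ 0# (begin
      l * a + ((d + 1#) * a + y)   ≡⟨ +-assoc (l * a) _ y ⟨
      l * a + (d + 1#) * a + y     ≡⟨ cong (_+ y) (*-distribʳ a l (d + 1#)) ⟨
      (l + (d + 1#)) * a + y       ≡⟨ e ⟨
      l * a                        ≡⟨ +-identityʳ (l * a) ⟨
      l * a + 0#                   ∎)
      where open ≡-Reasoning

    y≡0 : y ≡ 0#
    y≡0 = ≤-antisym (subst (y ≤_) rest≡0 y≤x+y) 0≤x

  quotient≤ : ∀ {a q x} → 0# < a → q * a ≡ x → q ≤ x
  quotient≤ {q = q} 0<a refl with e , refl ← <⇒+ 0<a =
    +⇒≤ (q * e) (solve 2 (λ q e → q :+ q :* e := q :* (con 0 :+ (e :+ con 1))) refl q e)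

  *-pos : ∀ {x y} → 0# < x → 0# < y → 0# < x * y
  *-pos 0<x 0<y with d , refl ← <⇒+ 0<x | e , refl ← <⇒+ 0<y =
    +⇒< (d * e + d + e)
      (solve 2 (λ d e → con 0 :+ (d :* e :+ d :+ e :+ con 1)
                     := (con 0 :+ (d :+ con 1)) :* (con 0 :+ (e :+ con 1))) refl d e)

  0<x+1 : ∀ {x} → 0# < x + 1#
  0<x+1 {x} = +⇒< x (+-identityˡ (x + 1#))

  -- Σ⁰₁-induction on `k` replaces a recursive product: each step multiplies `U` by the next term. A
  -- general arithmetic progression covers both the numbers 1, ..., k and the moduli.
  common-multiple : ∀ c d → (∀ i → 0# < c + (i + 1#) * d) → ∀ k →
                    Σ[ U ∈ 𝔻 ] 0# < U × (∀ i → i < k → c + (i + 1#) * d ∣ U)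
  common-multiple c d pos k =
    let (U , 0<U , h) = bounded k
    in U , 0<U , λ i i<k → let (q , _ , e) = h i i<k in q , e
    where
    -- Bounding the quotients by `U` leaves `U` as the only unbounded existential.
    Bounded : 𝔻 → Set ℓ
    Bounded k = Σ[ U ∈ 𝔻 ] 0# < U ×
      (∀ i → i < k → Σ[ q ∈ 𝔻 ] q ≤ U × q * (c + (i + 1#) * d) ≡ U)

    step : ∀ k → Bounded k → Bounded (k + 1#)
    step k (U , 0<U , h) = U * t , *-pos 0<U (pos k) , multiple
      where
      t = c + (k + 1#) * d
      multiple : ∀ i → i < k + 1# → Σ[ q ∈ 𝔻 ] q ≤ U * t × q * (c + (i + 1#) * d) ≡ U * t
      multiple i i≤k with ≤⇒<∨≡ i≤k
      ... | inj₂ refl = U , quotient≤ (pos k) refl , refl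
      ... | inj₁ i<k with q , _ , e ← h i i<k = q * t , quotient≤ (pos i) qt , qt
        where
        qt : q * t * (c + (i + 1#) * d) ≡ U * t
        qt = trans (solve 3 (λ q t s → q :* t :* s := q :* s :* t) refl q t (c + (i + 1#) * d))
                   (cong (_* t) e)

    bounded : ∀ k → Bounded k
    bounded = Σ⁰₁-ind
      (ex (and (lt 0̇ x₀)
        (all x₁ (ex (x₁ +̇ 1̇) (eq (x₀ ·̇ (x₄ +̇ (x₁ +̇ 1̇) ·̇ x₅)) x₂)))))
      (c ∷ d ∷ []) []
      (1# , subst (0# <_) (+-identityˡ 1#) 0<x+1 , λ i i<0 → contradiction i<0 x≮0) step

  -- The moduli of Gödel's β-function.
  module Moduli (M₀ b : 𝔻) (divides : ∀ i → i < b → i + 1# ∣ M₀) where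

    modulus : 𝔻 → 𝔻
    modulus i = 1# + (i + 1#) * M₀

    -- As `d + 1#` divides `M₀`, the modulus divides `q * ((i + 1#) * M₀)`. Adding `q` to this gives
    -- `q * modulus i`, so `q` is divisible as well.
    divides-difference : ∀ {i d q} → d < b → modulus i ∣ q * (d + 1#) → modulus i ∣ q
    divides-difference {i} {d} {q} d<b h with e , refl ← divides d d<b =
      ∣-+-cancelˡ (∣-*ˡ ((i + 1#) * e) h)
        (q , solve 4 (λ q i e d →
            q :* (con 1 :+ (i :+ con 1) :* (e :* (d :+ con 1)))
          := (i :+ con 1) :* e :* (q :* (d :+ con 1)) :+ q) refl q i e d)

    -- In place of a Bézout identity: (i + 1) · `modulus j` and (j + 1) · `modulus i` differ by
    -- exactly the distance of i and j. Hence `modulus i` divides `q` times that distance, and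
    -- `divides-difference` applies.
    coprime : ∀ {i j} q → i ≢ j → i < b → j < b →
              modulus i ∣ q * modulus j → modulus i ∣ q
    coprime {i} {j} q i≢j i<b j<b h with <-cmp i j
    ... | equal i≡j = contradiction i≡j i≢j
    ... | less i<j with d , refl ← <⇒+ i<j =
      divides-difference {i = i}
        (≤-<-trans (+⇒≤ (i + 1#)
          (solve 2 (λ d i → d :+ (i :+ con 1) := i :+ (d :+ con 1)) refl d i)) j<b)
        (∣-+-cancelˡ (∣-*ˡ (i + 1#) h)
          (q * (i + (d + 1#) + 1#) , solve 4 (λ q i d m →
              q :* (i :+ (d :+ con 1) :+ con 1) :* (con 1 :+ (i :+ con 1) :* m)
            := (i :+ con 1) :* (q :* (con 1 :+ (i :+ (d :+ con 1) :+ con 1) :* m))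
               :+ q :* (d :+ con 1))
            refl q i d M₀))
    ... | greater j<i with d , refl ← <⇒+ j<i =
      divides-difference {i = i}
        (≤-<-trans (+⇒≤ (j + 1#)
          (solve 2 (λ d j → d :+ (j :+ con 1) := j :+ (d :+ con 1)) refl d j)) i<b)
        (∣-+-cancelˡ (q * (j + 1#) , refl)
          (subst (modulus i ∣_)
            (solve 4 (λ q j d m →
                (j :+ (d :+ con 1) :+ con 1) :* (q :* (con 1 :+ (j :+ con 1) :* m))
              := q :* (j :+ con 1) :* (con 1 :+ (j :+ (d :+ con 1) :+ con 1) :* m)
                 :+ q :* (d :+ con 1))
              refl q j d M₀)
            (∣-*ˡ (i + 1#) h)))

    modulus-pos : ∀ i → 0# < modulus i
    modulus-pos i = subst (0# <_) (sym (1+x≡x+1 _)) 0<x+1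

    -- Removing the values F(0), F(1), … one at a time divides U by their moduli
    -- again and again, so the quotient would have to decrease forever.
    values-unbounded : ∀ {U} → 0# < M₀ → 0# < U → (∀ i → i < b → modulus i ∣ U) →
      ∀ F → (∀ n → Σ[ v ∈ 𝔻 ] pair n v ∈ F × v < b) →
      ¬ (∀ {n m v} → pair n v ∈ F → pair m v ∈ F → n ≡ m)
    values-unbounded {U} 0<M₀ 0<U U-multiple F total injective =
      -- One division more than `U` allows.
      let (v , _ , v+n≤U , _) = remaining (U + 1#)
      in <⇒≱ (<-≤-trans ≤-refl y≤x+y) v+n≤U
      where
      -- `v` is what `n` divisions leave of `U`: still a multiple of the modulus of every value not
      -- yet taken. The clause `v + n ≤ U` records that each division lowers it by at least one.
      Remaining : 𝔻 → Set ℓ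
      Remaining n = Σ[ v ∈ 𝔻 ] 0# < v × v + n ≤ U ×
        (∀ j → j < b → (∀ i → i < n → ¬ pair i j ∈ F) →
          Σ[ q ∈ 𝔻 ] q ≤ v × q * modulus j ≡ v)

      base : Remaining 0#
      base = U , 0<U , subst (_≤ U) (sym (+-identityʳ U)) ≤-refl ,
        λ j j<b _ → let (q , e) = U-multiple j j<b in q , quotient≤ (modulus-pos j) e , e

      step : ∀ n → Remaining n → Remaining (n + 1#)
      step n (v , 0<v , v+n≤U , h)
        with j₀ , nj₀ , j₀<b ← total n
        with q , _ , refl ← h j₀ j₀<b
               (λ i i<n ij₀ → contradiction (subst (_< n) (injective ij₀ nj₀) i<n) <-irrefl) =
        q , 0<q , ≤-trans smaller v+n≤U , λ j j<b unused →
          -- `j` is not the value at `n`, so its modulus divides `v` and, being coprime to the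
          -- modulus removed, also `q`.
          let (k , e) = coprime q
                (λ { refl → unused n ≤-refl nj₀ }) j<b j₀<b
                (let (l , _ , e) = h j j<b (λ i i<n → unused i (<⇒≤ i<n)) in l , e)
          in k , quotient≤ (modulus-pos j) e , e
        where
        0<q : 0# < q
        0<q with ≤⇒<∨≡ (0≤x {q})
        ... | inj₁ l    = l
        ... | inj₂ refl = contradiction (subst (0# <_) (*-zeroˡ _) 0<v) <-irrefl

        -- `q * modulus j₀` exceeds `q` by `q * ((j₀ + 1#) * M₀)`, which is positive.
        smaller : q + (n + 1#) ≤ q * modulus j₀ + n
        smaller with d , e ← <⇒+ (*-pos 0<q (*-pos (0<x+1 {j₀}) 0<M₀)) =
          +⇒≤ d (trans
            (solve 3 (λ q n d → q :+ (n :+ con 1) :+ d := q :+ (con 0 :+ (d :+ con 1)) :+ n)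
              refl q n d)
            (trans (cong (λ t → q + t + n) e)
              (solve 4 (λ q n j m → q :+ q :* ((j :+ con 1) :* m) :+ n
                                 := q :* (con 1 :+ (j :+ con 1) :* m) :+ n) refl q n j₀ M₀)))

      remaining : ∀ n → Remaining n
      remaining = Σ⁰₁-ind
        (ex (and (lt 0̇ x₀) (and (lt (x₀ +̇ x₁) (x₂ +̇ 1̇))
          (all x₄ (imp (all x₂ (neg (mem ⟪ x₀ , x₁ ⟫ X₀)))
            (ex (x₁ +̇ 1̇) (eq (x₀ ·̇ (1̇ +̇ (x₁ +̇ 1̇) ·̇ x₅)) x₂)))))))
        (U ∷ M₀ ∷ b ∷ []) (F ∷ []) base step

  -- A common multiple `M₀` of 1, ..., b makes the moduli coprime; a common multiple `U` of the
  -- moduli then codes the set of all numbers below `b`.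
  no-injection-below : ∀ F b → (∀ n → Σ[ v ∈ 𝔻 ] pair n v ∈ F × v < b) →
                       ¬ (∀ {n m v} → pair n v ∈ F → pair m v ∈ F → n ≡ m)
  no-injection-below F b total =
    let (M₀ , 0<M₀ , divides) =
          common-multiple 0# 1# (λ i → subst (0# <_) (sym (simplify i)) 0<x+1) b
        open Moduli M₀ b (λ i i<b → subst (_∣ M₀) (simplify i) (divides i i<b))
        (U , 0<U , U-multiple) = common-multiple 1# M₀ modulus-pos b
    in values-unbounded 0<M₀ 0<U U-multiple F total
    where
    simplify : ∀ i → 0# + (i + 1#) * 1# ≡ i + 1#
    simplify i = trans (+-identityˡ _) (*-identityʳ _)

module StableRamsey {ℓ : Level} (M : Structure ℓ) (isModel : M IsModelOf RCA₀) where
  open Arithmetic M isModel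

  -- From a stable coloring to a stable tournament.

  module FromColoring (c : 𝕊) (coloring : Sat M (Coloring X₀) [] (c ∷ [])) where

    Colored : 𝔻 → 𝔻 → 𝔻 → Set ℓ
    Colored x y i = pair (pair x y) i ∈ c

    two-colored : ∀ {x y} → x < y → Colored x y 0# ⊎ Colored x y 1#
    two-colored {x} {y} x<y
      with i , xyi ← proj₁ (proj₂ coloring) x y x<y
      with x′ , y′ , i′ , e , _ , color ← proj₁ coloring _ xyi
      with _ , refl ← pair-injective e
      with color
    ... | inj₁ refl = inj₁ xyi
    ... | inj₂ refl = inj₂ xyi

    not-both : ∀ {x y} → Colored x y 0# → ¬ Colored x y 1#
    not-both {x} {y} xy0 xy1 =
      x+1≢0 (trans (+-identityˡ 1#) (sym (proj₂ (proj₂ coloring) x y 0# 1# (xy0 , xy1))))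

    Edge : 𝔻 → 𝔻 → Set ℓ
    Edge x y = (x < y × Colored x y 1#) ⊎ (y < x × Colored y x 0#)

    edge-irrefl : ∀ {x} → ¬ Edge x x
    edge-irrefl (inj₁ (x<x , _)) = <-irrefl x<x
    edge-irrefl (inj₂ (x<x , _)) = <-irrefl x<x

    edge-asym : ∀ {x y} → Edge x y → ¬ Edge y x
    edge-asym (inj₁ (x<y , _))   (inj₁ (y<x , _))   = <-asym x<y y<x
    edge-asym (inj₁ (_ , xy1))   (inj₂ (_ , xy0))   = not-both xy0 xy1
    edge-asym (inj₂ (_ , yx0))   (inj₁ (_ , yx1))   = not-both yx0 yx1
    edge-asym (inj₂ (y<x , _))   (inj₂ (x<y , _))   = <-asym x<y y<x

    edge-total : ∀ {x y} → x ≢ y → Edge x y ⊎ Edge y x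
    edge-total {x} {y} x≢y with <-cmp x y
    ... | equal x≡y = contradiction x≡y x≢y
    ... | less x<y with two-colored x<y
    ...   | inj₁ xy0 = inj₂ (inj₂ (x<y , xy0))
    ...   | inj₂ xy1 = inj₁ (inj₁ (x<y , xy1))
    edge-total {x} {y} x≢y | greater y<x with two-colored y<x
    ...   | inj₁ yx0 = inj₁ (inj₂ (y<x , yx0))
    ...   | inj₂ yx1 = inj₂ (inj₁ (y<x , yx1))

    edge⇒1 : ∀ {x y} → x < y → Edge x y → Colored x y 1#
    edge⇒1 x<y (inj₁ (_ , xy1)) = xy1
    edge⇒1 x<y (inj₂ (y<x , _)) = contradiction y<x (<-asym x<y)

    edge⇒0 : ∀ {x y} → x < y → Edge y x → Colored x y 0#
    edge⇒0 x<y (inj₁ (y<x , _)) = contradiction y<x (<-asym x<y)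
    edge⇒0 x<y (inj₂ (_ , xy0)) = xy0

    abstract
      edges : Σ[ T ∈ 𝕊 ] (∀ q → q ∈ T → Σ[ x ∈ 𝔻 ] Σ[ y ∈ 𝔻 ] q ≡ pair x y) ×
                         (∀ x y → pair x y ∈ T ⟷ Edge x y)
      edges = relation-comp
        (or (and (lt x₁ x₀) (mem ⟪ ⟪ x₁ , x₀ ⟫ , 1̇ ⟫ X₀))
            (and (lt x₀ x₁) (mem ⟪ ⟪ x₀ , x₁ ⟫ , 0̇ ⟫ X₀))) [] (c ∷ [])

    T : 𝕊
    T = proj₁ edges

    T⟷Edge : ∀ x y → pair x y ∈ T ⟷ Edge x y
    T⟷Edge = proj₂ (proj₂ edges)

    tournament : Sat M (Tournament X₀) [] (T ∷ [])
    tournament = proj₁ (proj₂ edges) , (λ x → edge-irrefl ∘ to (T⟷Edge x x)) , exactly-one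
      where
      exactly-one : ∀ x y → x ≢ y →
        (pair x y ∈ T × ¬ pair y x ∈ T) ⊎ (¬ pair x y ∈ T × pair y x ∈ T)
      exactly-one x y x≢y with edge-total x≢y
      ... | inj₁ xy = inj₁ (from (T⟷Edge x y) xy , edge-asym xy ∘ to (T⟷Edge y x))
      ... | inj₂ yx = inj₂ (edge-asym yx ∘ to (T⟷Edge x y) , from (T⟷Edge y x) yx)

    tournament-stable : Sat M (StableColoring X₀) [] (c ∷ []) →
                        Sat M (StableRelation X₀) [] (T ∷ [])
    tournament-stable stable x with stable x
    -- The limit color is guaranteed only beyond both `b` and `x`; their sum serves as a single
    -- bound.
    ... | i , inj₁ refl , b , h = b + x , inj₂ λ z b+x<z →
      let x<z = ≤-<-trans y≤x+y b+x<z in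
      from (T⟷Edge z x) (inj₂ (x<z , h z (≤-<-trans x≤x+y b+x<z , x<z)))
    ... | i , inj₂ refl , b , h = b + x , inj₁ λ z b+x<z →
      let x<z = ≤-<-trans y≤x+y b+x<z in
      from (T⟷Edge x z) (inj₁ (x<z , h z (≤-<-trans x≤x+y b+x<z , x<z)))

  -- From a transitive subtournament to a stable linear order.

  module FromTransitive
    (T S : 𝕊)
    (tournament : Sat M (Tournament X₀) [] (T ∷ []))
    (stable     : Sat M (StableRelation X₀) [] (T ∷ []))
    (infinite   : Sat M (Infinite X₀) [] (S ∷ T ∷ []))
    (transitive : Sat M (TransitiveOn X₁ X₀) [] (S ∷ T ∷ []))
    where

    T-irrefl : ∀ {x} → ¬ pair x x ∈ T
    T-irrefl {x} = proj₁ (proj₂ tournament) x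

    T-total : ∀ x y → pair x y ∈ T ⊎ x ≡ y ⊎ pair y x ∈ T
    T-total x y with classical (x₀ ≐ x₁) (x ∷ y ∷ []) []
    ... | yes x≡y = inj₂ (inj₁ x≡y)
    ... | no x≢y with proj₂ (proj₂ tournament) x y x≢y
    ...   | inj₁ (xy , _) = inj₁ xy
    ...   | inj₂ (_ , yx) = inj₂ (inj₂ yx)

    s₀ : 𝔻
    s₀ = proj₁ (infinite 0#)

    s₀∈S : s₀ ∈ S
    s₀∈S = proj₂ (proj₂ (infinite 0#))

    -- The shift by s₀ ∈ S makes the maximum exist for every x.
    Floor : 𝔻 → 𝔻 → Set ℓ
    Floor x s = s ∈ S × s ≤ x + s₀ × (∀ u → u ≤ x + s₀ → u ∈ S → u ≤ s)

    -- Raising `x` by one admits a single new candidate, `x + 1# + s₀`. It becomes the maximum if it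
    -- lies in `S`; otherwise the old maximum persists.
    floor : ∀ x → Σ[ s ∈ 𝔻 ] Floor x s
    floor = Σ⁰₁-ind (ex (Δ⁰₀-maximumUpTo X₀ (x₁ +̇ x₂) x₀)) (s₀ ∷ []) (S ∷ []) base step
      where
      base : Σ[ s ∈ 𝔻 ] Floor 0# s
      base = s₀ , s₀∈S , y≤x+y , λ u u≤s₀ _ → subst (u ≤_) (+-identityˡ s₀) u≤s₀

      step : ∀ x → Σ[ s ∈ 𝔻 ] Floor x s → Σ[ s ∈ 𝔻 ] Floor (x + 1#) s
      step x (s , s∈S , s≤ , max) with classical (x₀ ∈̇ X₀) (x + 1# + s₀ ∷ []) (S ∷ [])
      ... | yes new = x + 1# + s₀ , new , ≤-refl , λ _ u≤ _ → u≤
      ... | no ¬new = s , s∈S , subst (s ≤_) (sym x+1+s₀) (<⇒≤ s≤) , max′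
        where
        x+1+s₀ : x + 1# + s₀ ≡ x + s₀ + 1#
        x+1+s₀ = solve 2 (λ x s → x :+ con 1 :+ s := x :+ s :+ con 1) refl x s₀

        max′ : ∀ u → u ≤ x + 1# + s₀ → u ∈ S → u ≤ s
        max′ u u≤ u∈S with ≤⇒<∨≡ u≤
        ... | inj₁ u< = max u (subst (u <_) x+1+s₀ u<) u∈S
        ... | inj₂ refl = contradiction u∈S ¬new

    floor-unique : ∀ {x s t} → Floor x s → Floor x t → s ≡ t
    floor-unique {s = s} {t} (s∈S , s≤ , s-max) (t∈S , t≤ , t-max) =
      ≤-antisym (t-max s s≤ s∈S) (s-max t t≤ t∈S)

    Below : 𝔻 → 𝔻 → Set ℓ
    Below x y = Σ[ s ∈ 𝔻 ] Σ[ t ∈ 𝔻 ]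
      Floor x s × Floor y t × (pair s t ∈ T ⊎ (s ≡ t × x < y))

    abstract
      order : Σ[ L ∈ 𝕊 ] (∀ q → q ∈ L → Σ[ x ∈ 𝔻 ] Σ[ y ∈ 𝔻 ] q ≡ pair x y) ×
                         (∀ x y → pair x y ∈ L ⟷ Below x y)
      order with L , binary , h ← relation-comp
              -- A floor of `x` is at most `x + s₀`, so both floors can be quantified over with
              -- bounds.
              (ex (x₁ +̇ x₂ +̇ 1̇) (ex (x₁ +̇ x₃ +̇ 1̇)
                (and (Δ⁰₀-maximumUpTo X₀ (x₃ +̇ x₄) x₁) (and (Δ⁰₀-maximumUpTo X₀ (x₂ +̇ x₄) x₀)
                  (or (mem ⟪ x₁ , x₀ ⟫ X₁) (and (eq x₁ x₀) (lt x₃ x₂)))))))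
              (s₀ ∷ []) (S ∷ T ∷ []) =
        L , binary , λ x y → mk⇔
          (λ r → let (s , _ , t , _ , below) = to (h x y) r in s , t , below)
          (λ (s , t , fs , ft , below) →
            from (h x y) (s , proj₁ (proj₂ fs) , t , proj₁ (proj₂ ft) , fs , ft , below))

    L : 𝕊
    L = proj₁ order

    L⟷Below : ∀ x y → pair x y ∈ L ⟷ Below x y
    L⟷Below = proj₂ (proj₂ order)

    below-irrefl : ∀ {x} → ¬ Below x x
    below-irrefl (s , t , fs , ft , below) with floor-unique fs ft
    below-irrefl (s , .s , fs , ft , inj₁ ss)        | refl = T-irrefl ss
    below-irrefl (s , .s , fs , ft , inj₂ (_ , x<x)) | refl = <-irrefl x<x

    -- Uniqueness identifies the two floors of `y`, and all floors lie in `S`, where `T` is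
    -- transitive.
    below-trans : ∀ {x y z} → Below x y → Below y z → Below x z
    below-trans (s , t , fs , ft , st) (t′ , u , ft′ , fu , tu) with floor-unique ft ft′
    ... | refl = s , u , fs , fu , join st tu
      where
      join : ∀ {x y z} → pair s t ∈ T ⊎ (s ≡ t × x < y) → pair t u ∈ T ⊎ (t ≡ u × y < z) →
             pair s u ∈ T ⊎ (s ≡ u × x < z)
      join (inj₁ st)           (inj₁ tu)           =
        inj₁ (transitive s t u (proj₁ fs , proj₁ ft , proj₁ fu) (st , tu))
      join (inj₁ st)           (inj₂ (refl , _))   = inj₁ st
      join (inj₂ (refl , _))   (inj₁ tu)           = inj₁ tu
      join (inj₂ (refl , x<y)) (inj₂ (refl , y<z)) = inj₂ (refl , <-trans x<y y<z)

    below-total : ∀ x y → Below x y ⊎ x ≡ y ⊎ Below y x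
    below-total x y with floor x | floor y
    ... | s , fs | t , ft with T-total s t
    ...   | inj₁ st        = inj₁ (s , t , fs , ft , inj₁ st)
    ...   | inj₂ (inj₂ ts) = inj₂ (inj₂ (t , s , ft , fs , inj₁ ts))
    ...   | inj₂ (inj₁ s≡t) with <-cmp x y
    ...     | less x<y    = inj₁ (s , t , fs , ft , inj₂ (s≡t , x<y))
    ...     | equal x≡y   = inj₂ (inj₁ x≡y)
    ...     | greater y<x = inj₂ (inj₂ (t , s , ft , fs , inj₂ (sym s≡t , y<x)))

    linear-order : Sat M (LinearOrder X₀) [] (L ∷ [])
    linear-order =
        proj₁ (proj₂ order)
      , (λ x → below-irrefl ∘ to (L⟷Below x x))
      , (λ x y z (xy , yz) →
          from (L⟷Below x z) (below-trans (to (L⟷Below x y) xy) (to (L⟷Below y z) yz)))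
      , total
      where
      total : ∀ x y → pair x y ∈ L ⊎ x ≡ y ⊎ pair y x ∈ L
      total x y with below-total x y
      ... | inj₁ xy        = inj₁ (from (L⟷Below x y) xy)
      ... | inj₂ (inj₁ e)  = inj₂ (inj₁ e)
      ... | inj₂ (inj₂ yx) = inj₂ (inj₂ (from (L⟷Below y x) yx))

    -- Since `S` is infinite, this makes floors tend to infinity, which carries stability from `T`
    -- to `L` and later makes `H` infinite.
    floor-≥ : ∀ {z t e} → e ∈ S → e ≤ z + s₀ → Floor z t → e ≤ t
    floor-≥ {e = e} e∈S e≤ (_ , _ , max) = max e e≤ e∈S

    order-stable : Sat M (StableRelation X₀) [] (L ∷ [])
    order-stable x with floor x
    ... | s , fs with stable s
    -- Beyond an element `e` of `S` above `b`, all floors are at least `e`, hence in the range where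
    -- `T` has settled with respect to `s`.
    ...   | b , limit with infinite b
    ...     | e , b<e , e∈S with limit
    ...       | inj₁ above = e , inj₁ λ z e<z → let (t , ft) = floor z in
      from (L⟷Below x z) (s , t , fs , ft ,
        inj₁ (above t (<-≤-trans b<e (floor-≥ e∈S (≤-trans (<⇒≤ e<z) x≤x+y) ft))))
    ...       | inj₂ below = e , inj₂ λ z e<z → let (t , ft) = floor z in
      from (L⟷Below z x) (t , s , ft , fs ,
        inj₁ (below t (<-≤-trans b<e (floor-≥ e∈S (≤-trans (<⇒≤ e<z) x≤x+y) ft))))

    -- A homogeneous set from a monotone sequence.

    module FromSequence
      (f : 𝕊)
      (function  : Sat M (Function X₀) [] (f ∷ L ∷ []))
      (injective : ∀ {n m v} → pair n v ∈ f → pair m v ∈ f → n ≡ m)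
      where

      functional : ∀ {n v w} → pair n v ∈ f → pair n w ∈ f → v ≡ w
      functional {n} {v} {w} nv nw = proj₂ (proj₂ function) n v w (nv , nw)

      -- For `y` in `S`, `u + s₀ < y` holds exactly when the floor of `u` is below `y`; earlier
      -- floors can thus be compared with `y` without being computed.
      ValuesBelow : 𝔻 → 𝔻 → Set ℓ
      ValuesBelow n y = ∀ m → m < n → Σ[ u ∈ 𝔻 ] u < y × (pair m u ∈ f × u + s₀ < y)

      FirstReaching : 𝔻 → 𝔻 → 𝔻 → Set ℓ
      FirstReaching y n v = pair n v ∈ f × y ≤ v + s₀ × ValuesBelow n y

      -- If no index were the first to reach `y`, induction would keep all values of `f` below `y`,
      -- against the pigeonhole principle.
      first-reaching : ∀ y → Σ[ n ∈ 𝔻 ] Σ[ v ∈ 𝔻 ] FirstReaching y n v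
      first-reaching y with classical
          (∃̇ ∃̇ (X₀ ∋⟨ x₁ , x₀ ⟩ ∧̇ x₂ <̇ x₀ +̇ x₃ +̇ 1̇ ∧̇ valuesBelow X₀ x₃ x₁ x₂))
          (y ∷ s₀ ∷ []) (f ∷ [])
      ... | yes reached = reached
      ... | no ¬reached = ⊥-elim (no-injection-below f y bounded injective)
        where
        step : ∀ n → ValuesBelow n y → ValuesBelow (n + 1#) y
        step n h m m≤n with ≤⇒<∨≡ m≤n
        ... | inj₁ m<n = h m m<n
        ... | inj₂ refl with v , nv ← proj₁ (proj₂ function) n with (v + s₀) <? y
        ...   | yes v+s₀<y = v , ≤-<-trans x≤x+y v+s₀<y , nv , v+s₀<y
        ...   | no v+s₀≮y = contradiction (n , v , nv , ≮⇒≥ v+s₀≮y , h) ¬reached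

        always : ∀ n → ValuesBelow n y
        always = Δ⁰₀-ind (Δ⁰₀-valuesBelow X₀ x₂ x₀ x₁) (y ∷ s₀ ∷ []) (f ∷ [])
          (λ m m<0 → contradiction m<0 x≮0) step

        bounded : ∀ n → Σ[ v ∈ 𝔻 ] pair n v ∈ f × v < y
        bounded n = let (v , v<y , nv , _) = always (n + 1#) n ≤-refl in v , nv , v<y

      -- The floors of f that exceed all earlier ones.
      Record : 𝔻 → Set ℓ
      Record y = Σ[ n ∈ 𝔻 ] Σ[ v ∈ 𝔻 ] pair n v ∈ f × ValuesBelow n y × Floor v y

      not-later : ∀ {y n v n′} → pair n v ∈ f → y ≤ v + s₀ → ValuesBelow n′ y → ¬ n < n′
      not-later {y} nv y≤ below n<n′ with below _ n<n′
      ... | u , _ , nu , u+s₀<y with refl ← functional nv nu = <⇒≱ u+s₀<y y≤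

      -- The index of a record `y` is the first one reaching `y`, and that index is unique. Being a
      -- record is thus also a statement about every first-reaching pair, which gives the Π⁰₁
      -- definition.
      record-floor : ∀ {y n v} → Record y → FirstReaching y n v → Floor v y
      record-floor {n = n} (n′ , v′ , nv′ , below′ , fl) (nv , y≤ , below) with <-cmp n n′
      ... | less n<n′    = contradiction n<n′ (not-later nv y≤ below′)
      ... | greater n′<n = contradiction n′<n (not-later nv′ (proj₁ (proj₂ fl)) below)
      ... | equal refl with refl ← functional nv nv′ = fl

      abstract
        records : Σ[ H ∈ 𝕊 ] (∀ y → y ∈ H ⟷ Record y)
        records with H , h ← Δ⁰₁-comp
                -- One unbounded quantifier serves as a common bound for `n` and `v`; `n + v + 1#`
                -- is always large enough.
                (ex (ex x₀ (ex x₁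
                  (and (mem ⟪ x₁ , x₀ ⟫ X₀)
                  (and (Δ⁰₀-valuesBelow X₀ x₄ x₁ x₃)
                       (Δ⁰₀-maximumUpTo X₁ (x₀ +̇ x₄) x₃))))))
                (all (all x₀ (all x₁
                  (imp (and (mem ⟪ x₁ , x₀ ⟫ X₀)
                       (and (lt x₃ (x₀ +̇ x₄ +̇ 1̇)) (Δ⁰₀-valuesBelow X₀ x₄ x₁ x₃)))
                       (Δ⁰₀-maximumUpTo X₁ (x₀ +̇ x₄) x₃)))))
                (s₀ ∷ []) (f ∷ S ∷ [])
                (λ y → mk⇔
                  (λ (w , n , _ , v , _ , r) w′ n′ _ v′ _ reach → record-floor (n , v , r) reach)
                  -- The universal form is not vacuous: some pair first reaches `y`, and its value
                  -- has floor `y`.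
                  (λ h → let (n , v , nv , y≤ , below) = first-reaching y in
                    n + v + 1# , n , x≤x+y , v , y≤x+y , nv , below ,
                    h (n + v + 1#) n x≤x+y v y≤x+y (nv , y≤ , below))) =
          H , λ y → mk⇔
            (λ y∈H → let (_ , n , _ , v , _ , r) = to (h y) y∈H in n , v , r)
            (λ (n , v , r) → from (h y) (n + v + 1# , n , x≤x+y , v , y≤x+y , r))

      H : 𝕊
      H = proj₁ records

      H⟷Record : ∀ y → y ∈ H ⟷ Record y
      H⟷Record = proj₂ records

      -- The first value reaching an element `e` of `S` above `k` has a floor of at least `e`, while
      -- all earlier values stay below `e`; so this floor is a record.
      H-infinite : ∀ k → Σ[ y ∈ 𝔻 ] k < y × y ∈ H
      H-infinite k =
        let (e , k<e , e∈S) = infinite k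
            (n , v , nv , e≤ , below) = first-reaching e
            (y , fy) = floor v
            e≤y = floor-≥ e∈S e≤ fy
        in y , <-≤-trans k<e e≤y , from (H⟷Record y)
             (n , v , nv ,
              (λ m m<n → let (u , u<e , mu , u+s₀<e) = below m m<n
                         in u , <-≤-trans u<e e≤y , mu , <-≤-trans u+s₀<e e≤y) ,
              fy)

      -- A larger record occurs later: had it come before `y`, a value reaching `y` would precede
      -- the index of `y`.
      H-increasing : ∀ {y y′} → y < y′ → y ∈ H → y′ ∈ H →
        Σ[ n ∈ 𝔻 ] Σ[ n′ ∈ 𝔻 ] Σ[ v ∈ 𝔻 ] Σ[ v′ ∈ 𝔻 ]
          (n < n′ × pair n v ∈ f × pair n′ v′ ∈ f) × Floor v y × Floor v′ y′
      H-increasing {y} {y′} y<y′ y∈H y′∈H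
        with n , v , nv , below , fl ← to (H⟷Record y) y∈H
           | n′ , v′ , nv′ , below′ , fl′ ← to (H⟷Record y′) y′∈H
        with <-cmp n n′
      ... | less n<n′ = n , n′ , v , v′ , (n<n′ , nv , nv′) , fl , fl′
      ... | greater n′<n = contradiction n′<n
              (not-later nv′ (≤-trans (<⇒≤ y<y′) (proj₁ (proj₂ fl′))) below)
      ... | equal refl with refl ← functional nv nv′ with refl ← floor-unique fl fl′ =
              contradiction y<y′ <-irrefl

    below⇒T : ∀ {v v′ y y′} → y ≢ y′ → Floor v y → Floor v′ y′ → Below v v′ → pair y y′ ∈ T
    below⇒T y≢y′ fl fl′ (s , t , fs , ft , below)
      with refl ← floor-unique fl fs | refl ← floor-unique fl′ ft with below
    ... | inj₁ st          = st
    -- Ties are excluded because distinct elements of `H` are distinct floors.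
    ... | inj₂ (s≡t , _)   = contradiction s≡t y≢y′

    homogeneous : (f : 𝕊) → Sat M (Function X₀) [] (f ∷ L ∷ []) →
                  Sat M (Ascending X₀ X₁ ∨̇ Descending X₀ X₁) [] (f ∷ L ∷ []) →
                  Σ[ H ∈ 𝕊 ] (∀ k → Σ[ y ∈ 𝔻 ] k < y × y ∈ H) ×
                    ((∀ {x y} → x ∈ H → y ∈ H → x < y → pair x y ∈ T) ⊎
                     (∀ {x y} → x ∈ H → y ∈ H → x < y → pair y x ∈ T))
    homogeneous f function (inj₁ ascending) = H , H-infinite , inj₁ λ x∈H y∈H x<y →
      let (n , n′ , v , v′ , n<n′ , fx , fy) = H-increasing x<y x∈H y∈H
      in below⇒T (λ { refl → <-irrefl x<y }) fx fy
           (to (L⟷Below v v′) (ascending n n′ v v′ n<n′))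
      where
      -- A value taken twice by a monotone sequence would lie below itself in `L`.
      open FromSequence f function (collision-free⇒injective λ {n} {m} {v} n<m nv mv →
        below-irrefl (to (L⟷Below v v) (ascending n m v v (n<m , nv , mv))))
    homogeneous f function (inj₂ descending) = H , H-infinite , inj₂ λ x∈H y∈H x<y →
      let (n , n′ , v , v′ , n<n′ , fx , fy) = H-increasing x<y x∈H y∈H
      in below⇒T (λ { refl → <-irrefl x<y }) fy fx
           (to (L⟷Below v′ v) (descending n n′ v v′ n<n′))
      where
      open FromSequence f function (collision-free⇒injective λ {n} {m} {v} n<m nv mv →
        below-irrefl (to (L⟷Below v v) (descending n m v v (n<m , nv , mv))))

  -- Assembling the implication.

  stable-ramsey : Sat M SEM [] [] → Sat M SADS [] [] → Sat M SRT²₂ [] []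
  stable-ramsey sem sads c (coloring , stable) =
    let open FromColoring c coloring
        T-stable = tournament-stable stable
        (S , infinite , transitive) = sem T (tournament , T-stable)
        open FromTransitive T S tournament T-stable infinite transitive
          using (L; linear-order; order-stable; homogeneous)
        (f , function , monotone) = sads L (linear-order , order-stable)
        (H , H-infinite , H-homogeneous) = homogeneous f function monotone
    in H , H-infinite , (case H-homogeneous of λ where
      (inj₁ up) → 1# , inj₂ refl , λ x y (x∈H , y∈H , x<y) →
        edge⇒1 x<y (to (T⟷Edge x y) (up x∈H y∈H x<y))
      (inj₂ down) → 0# , inj₁ refl , λ x y (x∈H , y∈H , x<y) →
        edge⇒0 x<y (to (T⟷Edge y x) (down x∈H y∈H x<y)))

corollary1p14 : (ℓ : Level) → RCA₀ ⊨[ ℓ ] (SEM ∧̇ SADS ⇒ SRT²₂)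
corollary1p14 ℓ M isModel (sem , sads) = StableRamsey.stable-ramsey M isModel sem sads
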